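{- Let $\vec d=(\vec a,\vec b)$ be a bidegree sequence of length $n$ with $\sum_i a_i=\sum_i b_i=n\bar c$ and $m:=\min\vec d\in[1..n]$. Define $k_*=m+\sqrt{m^2+n(\bar c-2m)}$, and let $k=\lceil k_*\rceil$ if $m^2+n(\bar c-2m)\ge0$ (i.e. $k_*$ is real) and $k=1$ otherwise. If $$\max\vec d\le\min\Big(\Big\lfloor n\frac{\bar c-m}{k}+m\Big\rfloor,\ n\Big),$$ then $\vec d$ is graphic with loops.
   Context: A bidegree sequence of length $n$ is a pair $\vec d=(\vec a,\vec b)$ with $\vec a=(a_1,\dots,a_n)\in\mathbb{N}_0^n$ and $\vec b=(b_1,\dots,b_n)\in\mathbb{N}_0^n$. It is graphic with loops if there is an $n\times n$ matrix with entries in $\{0,1\}$ whose $i$th row sum is $a_i$ and whose $i$th column sum is $b_i$ for every $i\in[1..n]$; it is graphic if such a matrix exists with all diagonal entries equal to $0$. $\max\vec d$ and $\min\vec d$ denote the maximum and minimum over all $2n$ entries $a_1,\dots,a_n,b_1,\dots,b_n$. The number $\bar c$ (the average degree) is defined by $\sum_i a_i=\sum_i b_i=n\bar c$. For integers $a\le b$, $[a..b]:=\{x\in\mathbb{Z}:a\le x\le b\}$. -}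

module Defs where

open import Data.Fin using (Fin; toℕ)
open import Data.Integer as ℤ using (ℤ; +_)
import Data.Integer.Properties as ℤₚ
open import Data.Nat as ℕ using (ℕ)
import Data.Nat.Properties as ℕₚ
open import Data.Product using (∃; _×_; _,_; proj₁; proj₂)
open import Data.Rational as ℚ using (ℚ; 0ℚ)
open import Data.Rational.Literals using (fromℤ)
import Data.Rational.Properties as ℚₚ
open import Data.Vec.Functional using (Vector; _++_)
open import Data.Vec.Functional.Relation.Unary.All using (All)
open import Data.Vec.Functional.Relation.Unary.Any using (Any)
open import Relation.Binary.PropositionalEquality
open import Relation.Nullary using (¬_; yes; no)

open import Algebra.Properties.CommutativeMonoid.Sum ℕₚ.+-0-commutativeMonoid public
  using (sum)

BidegreeSequence : ℕ → Set
BidegreeSequence n = Vector ℕ n × Vector ℕ n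

entries : ∀ {n} → BidegreeSequence n → Vector ℕ (n ℕ.+ n)
entries (a , b) = a ++ b

IsMin IsMax : ∀ {n} → Vector ℕ n → ℕ → Set
IsMin v m = Any (m ≡_) v × All (m ℕ.≤_) v
IsMax v M = Any (M ≡_) v × All (ℕ._≤ M) v

GraphicWithLoops : ∀ {n} → BidegreeSequence n → Set
GraphicWithLoops {n} (a , b) =
  ∃ λ (A : Fin n → Fin n → Fin 2) →
      (∀ i → sum (λ j → toℕ (A i j)) ≡ a i)
    × (∀ j → sum (λ i → toℕ (A i j)) ≡ b j)

fromℕ : ℕ → ℚ
fromℕ n = fromℤ (+ n)

-- A real number x is represented by its closed upper cut { q ∈ ℚ ∣ x ≤ q }.
UpperCut : Set₁
UpperCut = ℚ → Set

-- For D ≥ 0 this is the cut of the nonnegative real root of D: √ D ≤ q holds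
-- iff 0 ≤ q and D ≤ q².  It is not meaningful for D < 0.
√_ : ℚ → UpperCut
(√ D) q = 0ℚ ℚ.≤ q × D ℚ.≤ q ℚ.* q

-- p + x ≤ q iff x ≤ q - p.
_⊕_ : ℚ → UpperCut → UpperCut
(p ⊕ x) q = x (q ℚ.- p)

infix  8 √_
infixr 6 _⊕_

-- k is the least integer with x ≤ k.
IsCeiling : UpperCut → ℤ → Set
IsCeiling x k = x (fromℤ k) × (∀ j → x (fromℤ j) → k ℤ.≤ j)

module _ (n m : ℕ) (c̄ : ℚ) where

  -- m² + n (c̄ - 2m)
  radicand : ℚ
  radicand = fromℕ m ℚ.* fromℕ m
       ℚ.+ fromℕ n ℚ.* (c̄ ℚ.- fromℕ 2 ℚ.* fromℕ m)

  k* : UpperCut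
  k* = fromℕ m ⊕ √ radicand

  IsK : ℤ → Set
  IsK k = (0ℚ ℚ.≤ radicand → IsCeiling k* k)
        × (¬ 0ℚ ℚ.≤ radicand → k ≡ + 1)

  -- Makes the division by k in the degree bound well defined.
  IsK⇒nonZero : ∀ {k} → 1 ℕ.≤ m → IsK k → ℚ.NonZero (fromℤ k)
  IsK⇒nonZero {k} 1≤m (real , nonreal) with 0ℚ ℚ.≤? radicand
  ... | no  D≱0 rewrite nonreal D≱0 = _
  ... | yes D≥0 = ℤ.>-nonZero (ℤₚ.<-≤-trans (ℤ.+<+ 1≤m) m≤k)
    where
    open ℚₚ.≤-Reasoning
    p q : ℚ
    p = fromℕ m
    q = fromℤ k
    p≤q : p ℚ.≤ q
    p≤q = begin
      p                  ≡⟨ ℚₚ.+-identityˡ p ⟨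
      0ℚ ℚ.+ p           ≤⟨ ℚₚ.+-monoˡ-≤ p (proj₁ (proj₁ (real D≥0))) ⟩
      (q ℚ.- p) ℚ.+ p    ≡⟨ ℚₚ.+-assoc q (ℚ.- p) p ⟩
      q ℚ.+ (ℚ.- p ℚ.+ p) ≡⟨ cong (q ℚ.+_) (ℚₚ.+-inverseˡ p) ⟩
      q ℚ.+ 0ℚ           ≡⟨ ℚₚ.+-identityʳ q ⟩
      q                  ∎
    m≤k : + m ℤ.≤ k
    m≤k = subst₂ ℤ._≤_ (ℤₚ.*-identityʳ (+ m)) (ℤₚ.*-identityʳ k) (ℚₚ.drop-*≤* p≤q)

-- ⌊ n (c̄ - m) / k + m ⌋
degreeBound : (n m : ℕ) (c̄ : ℚ) (k : ℤ) .{{_ : ℚ.NonZero (fromℤ k)}} → ℤ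
degreeBound n m c̄ k =
  ℚ.floor (fromℕ n ℚ.* ((c̄ ℚ.- fromℕ m) ℚ.÷ fromℤ k) ℚ.+ fromℕ m)

{-# OPTIONS --safe #-}

-- By a Gale–Ryser theorem it suffices that X + Y ≤ S + r s whenever X is a sum
-- of r of the row sums, Y a sum of s of the column sums and S the total.  The
-- sufficiency is proved row by row: a row is given to the columns with the
-- largest demand, and by comparing r with the least demand served, the new
-- condition at r is the old one at r or at r + 1.
--
-- The inequality follows from X ≤ r M and X + n m ≤ S + r m (and the same for
-- Y, s).  It is immediate if r or s is at least M or at most m.  In between,
-- with D the radicand: if D ≤ 0, adding the two lower-bound estimates leaves
-- (r - m)(s - m) - D ≥ 0; if (M - m)² ≤ D then M² ≤ S, which suffices; and
-- otherwise k ≤ M, where k (M - m) ≤ S - n m and D ≤ (k - m)² settle each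
-- position of r, s relative to k.

module Submission where

open import Defs
open import Algebra.Properties.CommutativeMonoid.Sum as Sum using ()
open import Data.Fin using (Fin; zero; suc; toℕ; fromℕ<)
open import Data.Fin.Properties using (toℕ-fromℕ<; toℕ≤pred[n])
open import Data.Nat as ℕ using (ℕ)
open import Data.Product using (∃; _×_; _,_; proj₁; proj₂)
open import Data.Sum using (inj₁; inj₂)
open import Data.Vec.Functional using (Vector; []; _∷_)
import Data.Vec.Functional.Relation.Unary.All.Properties as All
open import Function using (_∘_)
open import Relation.Binary.PropositionalEquality
  using (_≡_; refl; sym; trans; cong; cong₂; subst; subst₂; module ≡-Reasoning)
open import Relation.Nullary using (yes; no)

-- A Gale-Ryser theorem: 0-1 matrices with prescribed row and column sums.

module GaleRyser where

  open import Data.Nat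
  open import Data.Nat.Properties

  open Sum +-0-commutativeMonoid using (∑-distrib-+; sum-cong-≗)

  private
    variable
      n p q : ℕ

  sum-mono : {u v : Vector ℕ n} → (∀ i → u i ≤ v i) → sum u ≤ sum v
  sum-mono {zero}  u≤v = z≤n
  sum-mono {suc n} u≤v = +-mono-≤ (u≤v zero) (sum-mono (u≤v ∘ suc))

  sum-const : ∀ n x → sum {n} (λ _ → x) ≡ n * x
  sum-const zero    x = refl
  sum-const (suc n) x = cong (x +_) (sum-const n x)

  sum-zero : sum {n} (λ _ → 0) ≡ 0
  sum-zero {n} = trans (sum-const n 0) (*-zeroʳ n)

  sum-*ʳ : ∀ (u : Vector ℕ n) x → sum (λ i → u i * x) ≡ sum u * x
  sum-*ʳ {zero}  u x = refl
  sum-*ʳ {suc n} u x =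
    trans (cong (u zero * x +_) (sum-*ʳ (u ∘ suc) x)) (sym (*-distribʳ-+ x (u zero) _))

  lookup≤sum : ∀ (u : Vector ℕ n) i → u i ≤ sum u
  lookup≤sum u zero    = m≤m+n _ _
  lookup≤sum u (suc i) = ≤-trans (lookup≤sum (u ∘ suc) i) (m≤n+m _ (u zero))

  -- A discrete intermediate value argument: walk down from `N` until `f` first reaches `t`.
  descent : ∀ (f : ℕ → ℕ) N {t} → t ≤ f 0 → f (suc N) ≤ t →
            ∃ λ v → t ≤ f v × f (suc v) ≤ t
  descent f zero    t≤f0 f1≤t = 0 , t≤f0 , f1≤t
  descent f (suc N) {t} t≤f0 fN≤t with ≤-total t (f (suc N))
  ... | inj₁ t≤fN = suc N , t≤fN , fN≤t
  ... | inj₂ fN≤t′ = descent f N t≤f0 fN≤t′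

  -- Greedy filling from the left: coordinates are raised to `v` while the rest can stay at `u`; the
  -- one that would overshoot takes exactly what is missing, and all later ones stay at `u`.
  interpolate : ∀ {u v : Vector ℕ n} {t} → (∀ i → u i ≤ v i) → sum u ≤ t → t ≤ sum v →
                ∃ λ (w : Vector ℕ n) → (∀ i → u i ≤ w i) × (∀ i → w i ≤ v i) × sum w ≡ t
  interpolate {zero} _ _ t≤0 = [] , (λ ()) , (λ ()) , sym (n≤0⇒n≡0 t≤0)
  interpolate {suc n} {u} {v} {t} u≤v Σu≤t t≤Σv with ≤-total (v zero + sum (u ∘ suc)) t
  ... | inj₁ v₀+Σu≤t =
    let v₀≤t = m+n≤o⇒m≤o (v zero) v₀+Σu≤t
        w , u≤w , w≤v , Σw≡ = interpolate {t = t ∸ v zero} (u≤v ∘ suc)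
          (m+n≤o⇒m≤o∸n _ (subst (_≤ t) (+-comm (v zero) _) v₀+Σu≤t))
          (m≤n+o⇒m∸n≤o t (v zero) t≤Σv)
    in v zero ∷ w
     , (λ { zero → u≤v zero ; (suc i) → u≤w i })
     , (λ { zero → ≤-refl ; (suc i) → w≤v i })
     , trans (cong (v zero +_) Σw≡) (m+[n∸m]≡n v₀≤t)
  ... | inj₂ t≤v₀+Σu =
    t ∸ sum (u ∘ suc) ∷ u ∘ suc
     , (λ { zero → m+n≤o⇒m≤o∸n _ Σu≤t ; (suc i) → ≤-refl })
     , (λ { zero → m≤n+o⇒m∸n≤o t _ (subst (t ≤_) (+-comm (v zero) _) t≤v₀+Σu) ; (suc i) → u≤v (suc i) })
     , m∸n+n≡m (m+n≤o⇒n≤o (u zero) Σu≤t)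

  -- The Iverson bracket of v < x, written with `⊓` and `∸` so that its monotonicity and its bounds
  -- come from theirs.
  [_<_]ᵢ : ℕ → ℕ → ℕ
  [ v < x ]ᵢ = 1 ⊓ (x ∸ v)

  -- Chooses `t` columns of largest demand without sorting. At the level `v` where the number of
  -- columns above it crosses `t`, all columns of demand above v + 1 are taken, and columns of
  -- demand exactly v + 1 fill up the rest.
  select : ∀ (b : Vector ℕ q) {t} → t ≤ sum (λ j → [ 0 < b j ]ᵢ) →
           ∃ λ v → ∃ λ (c : Vector ℕ q) →
             (∀ j → [ suc v < b j ]ᵢ ≤ c j) × (∀ j → c j ≤ [ v < b j ]ᵢ) × sum c ≡ t
  select {q} b {t} t≤ with
    -- No single demand exceeds `sum b`, so the count has dropped to 0 by then.
    descent (λ v → sum (λ j → [ v < b j ]ᵢ)) (sum b) t≤ (≤-trans (≤-reflexive vanishes) z≤n)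
    where
    vanishes : sum (λ j → [ suc (sum b) < b j ]ᵢ) ≡ 0
    vanishes = trans
      (sum-cong-≗ λ j → cong (1 ⊓_) (m≤n⇒m∸n≡0 (m≤n⇒m≤1+n (lookup≤sum b j)))) (sum-zero {n = q})
  ... | v , t≤v , v+1≤t =
    v , interpolate (λ j → ⊓-monoʳ-≤ 1 (∸-monoʳ-≤ (b j) (n≤1+n v))) v+1≤t t≤v

  [<]≤1 : ∀ v x → [ v < x ]ᵢ ≤ 1
  [<]≤1 v x = m⊓n≤m 1 (x ∸ v)

  -- A served column has demand above `v`, so after losing one unit it still has at least `r`, and
  -- the cap hides the loss.
  ⊓-remove-low : ∀ {x c v r} → r ≤ v → c ≤ [ v < x ]ᵢ → (x ∸ c) ⊓ r ≡ x ⊓ r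
  ⊓-remove-low {x} {zero} _ _ = refl
  ⊓-remove-low {x} {suc c} {v} {r} r≤v c≤ =
    trans (m≥n⇒m⊓n≡n r≤x∸c) (sym (m≥n⇒m⊓n≡n (≤-trans r≤x∸c (m∸n≤m x (suc c)))))
    where
    c≤x∸v : suc c ≤ x ∸ v
    c≤x∸v = ≤-trans c≤ (m⊓n≤n 1 _)
    v≤x : v ≤ x
    v≤x = <⇒≤ (m∸n≢0⇒n<m (m<n⇒n≢0 c≤x∸v))
    r≤x∸c : r ≤ x ∸ suc c
    r≤x∸c = m+n≤o⇒m≤o∸n r
      (≤-trans (+-mono-≤ r≤v c≤x∸v) (≤-reflexive (m+[n∸m]≡n v≤x)))

  -- At r > v the removal of c is paid for by raising the cap on x to r + 1.
  ⊓-remove-high : ∀ {x c v r} → v < r → [ suc v < x ]ᵢ ≤ c → c ≤ [ v < x ]ᵢ →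
                  (x ∸ c) ⊓ r + c ≡ x ⊓ suc r
  ⊓-remove-high {x} {zero} {v} {r} v<r ≤c _ = trans (+-identityʳ _)
    (trans (m≤n⇒m⊓n≡m x≤r) (sym (m≤n⇒m⊓n≡m (m≤n⇒m≤1+n x≤r))))
    where
    x≤r : x ≤ r
    x≤r with x ≤? suc v
    ... | yes x≤ = ≤-trans x≤ v<r
    -- A demand above v + 1 would have forced `c` to be at least 1.
    ... | no x≰ with () ← ≤-trans (⊓-glb (s≤s z≤n) (m<n⇒0<n∸m (≰⇒> x≰))) ≤c
  ⊓-remove-high {zero} {suc c} {v} v<r _ c≤ with () ← ≤-trans c≤ (≤-trans (m⊓n≤n 1 (0 ∸ v)) (≤-reflexive (0∸n≡0 v)))
  ⊓-remove-high {suc x} {suc zero} {v} {r} _ _ _ = +-comm (x ⊓ r) 1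
  ⊓-remove-high {suc x} {suc (suc c)} {v} _ _ c≤ with s≤s () ← ≤-trans c≤ ([<]≤1 v (suc x))

  -- Column `j` can hold at most `b j` ones and meets the rows of `I` in `sum (toℕ ∘ I)` cells,
  -- whence the capped sum. Quantifying over all sets of rows avoids ordering them.
  galeRyser : ∀ (a : Vector ℕ p) (b : Vector ℕ q) → sum a ≡ sum b →
              (∀ (I : Vector (Fin 2) p) →
                sum (λ i → toℕ (I i) * a i) ≤ sum (λ j → b j ⊓ sum (toℕ ∘ I))) →
              ∃ λ (A : Fin p → Fin q → Fin 2) →
                  (∀ i → sum (λ j → toℕ (A i j)) ≡ a i)
                × (∀ j → sum (λ i → toℕ (A i j)) ≡ b j)
  galeRyser {zero} a b Σa≡Σb _ =
    (λ ()) , (λ ()) , λ j → sym (n≤0⇒n≡0 (subst (b j ≤_) (sym Σa≡Σb) (lookup≤sum b j)))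
  galeRyser {suc p} {q} a b Σa≡Σb cond =
    let A , rows , cols = galeRyser (a ∘ suc) b′ Σa′≡Σb′ cond′
    in (λ { zero j → C j ; (suc i) j → A i j })
     , (λ { zero → trans (sum-cong-≗ toℕ-C) Σc≡a₀ ; (suc i) → rows i })
     , (λ j → trans (cong₂ _+_ (toℕ-C j) (cols j)) (m+[n∸m]≡n (c≤b j)))
    where
    open ≤-Reasoning

    -- The condition for the first row alone: demands capped at 1 count the columns still open.
    a₀≤ : a zero ≤ sum (λ j → [ 0 < b j ]ᵢ)
    a₀≤ = begin
      a zero                                   ≡⟨ +-identityʳ _ ⟨
      a zero + 0                               ≡⟨ cong₂ _+_ (*-identityˡ _) (sum-zero {n = p}) ⟨
      1 * a zero + sum {p} (λ _ → 0)           ≤⟨ cond (suc zero ∷ λ _ → zero) ⟩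
      sum (λ j → b j ⊓ suc (sum {p} λ _ → 0))  ≡⟨ sum-cong-≗ (λ j → trans (cong (λ s → b j ⊓ suc s) (sum-zero {n = p})) (⊓-comm (b j) 1)) ⟩
      sum (λ j → [ 0 < b j ]ᵢ)                 ∎

    selected = select b a₀≤
    v        = proj₁ selected
    c        = proj₁ (proj₂ selected)
    >v+1⇒c   = proj₁ (proj₂ (proj₂ selected))
    c⇒>v     = proj₁ (proj₂ (proj₂ (proj₂ selected)))
    Σc≡a₀    = proj₂ (proj₂ (proj₂ (proj₂ selected)))

    b′ : Vector ℕ q
    b′ j = b j ∸ c j

    c≤b : ∀ j → c j ≤ b j
    c≤b j = ≤-trans (c⇒>v j) (≤-trans (m⊓n≤n 1 _) (m∸n≤m (b j) v))

    C : Vector (Fin 2) q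
    C j = fromℕ< (s≤s (≤-trans (c⇒>v j) ([<]≤1 v (b j))))

    toℕ-C : ∀ j → toℕ (C j) ≡ c j
    toℕ-C j = toℕ-fromℕ< _

    Σa′≡Σb′ : sum (a ∘ suc) ≡ sum b′
    Σa′≡Σb′ = +-cancelˡ-≡ (a zero) _ _ (begin-equality
      sum a                   ≡⟨ Σa≡Σb ⟩
      sum b                   ≡⟨ sum-cong-≗ (λ j → m+[n∸m]≡n (c≤b j)) ⟨
      sum (λ j → c j + b′ j)  ≡⟨ ∑-distrib-+ c b′ ⟩
      sum c + sum b′          ≡⟨ cong (_+ sum b′) Σc≡a₀ ⟩
      a zero + sum b′         ∎)

    cond′ : ∀ (I : Vector (Fin 2) p) →
            sum (λ i → toℕ (I i) * a (suc i)) ≤ sum (λ j → b′ j ⊓ sum (toℕ ∘ I))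
    cond′ I with sum (toℕ ∘ I) in |I|≡r
    ... | r with r ≤? v
    -- Below the served level the removal is invisible, so the old condition for the same rows
    -- suffices.
    ... | yes r≤v = begin
      sum (λ i → toℕ (I i) * a (suc i))  ≤⟨ cond (zero ∷ I) ⟩
      sum (λ j → b j ⊓ sum (toℕ ∘ I))    ≡⟨ sum-cong-≗ (λ j → cong (b j ⊓_) |I|≡r) ⟩
      sum (λ j → b j ⊓ r)                ≡⟨ sum-cong-≗ (λ j → ⊓-remove-low r≤v (c⇒>v j)) ⟨
      sum (λ j → b′ j ⊓ r)               ∎
    -- Here the first row joins `I`: the cap rises by one, which releases exactly the `a zero` units
    -- just removed.
    ... | no r≰v = +-cancelˡ-≤ (a zero) _ _ (begin
      a zero + sum (λ i → toℕ (I i) * a (suc i))      ≡⟨ cong (_+ sum (λ i → toℕ (I i) * a (suc i))) (*-identityˡ (a zero)) ⟨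
      1 * a zero + sum (λ i → toℕ (I i) * a (suc i))  ≤⟨ cond (suc zero ∷ I) ⟩
      sum (λ j → b j ⊓ suc (sum (toℕ ∘ I)))           ≡⟨ sum-cong-≗ (λ j → cong (λ s → b j ⊓ suc s) |I|≡r) ⟩
      sum (λ j → b j ⊓ suc r)                         ≡⟨ sum-cong-≗ (λ j → ⊓-remove-high (≰⇒> r≰v) (>v+1⇒c j) (c⇒>v j)) ⟨
      sum (λ j → b′ j ⊓ r + c j)                      ≡⟨ ∑-distrib-+ (λ j → b′ j ⊓ r) c ⟩
      sum (λ j → b′ j ⊓ r) + sum c                    ≡⟨ cong (sum (λ j → b′ j ⊓ r) +_) Σc≡a₀ ⟩
      sum (λ j → b′ j ⊓ r) + a zero                   ≡⟨ +-comm _ (a zero) ⟩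
      a zero + sum (λ j → b′ j ⊓ r)                   ∎)

  -- Capping replaces x by r exactly when r < x; both sides are arranged to avoid subtraction.
  ⊓-cut : ∀ x r → x ⊓ r + [ r < x ]ᵢ * x ≡ x + [ r < x ]ᵢ * r
  ⊓-cut x r with x ≤? r
  ... | yes x≤r rewrite m≤n⇒m∸n≡0 x≤r = cong (_+ 0) (m≤n⇒m⊓n≡m x≤r)
  ... | no  x≰r rewrite m≤n⇒m⊓n≡m (m<n⇒0<n∸m (≰⇒> x≰r)) | m≥n⇒m⊓n≡n (≰⇒≥ x≰r)
                | *-identityˡ x | *-identityˡ r = +-comm r x

  -- The capped sum is the minimum over `J` of the demands outside `J` plus r times the size of `J`.
  -- The resulting condition treats rows and columns alike.
  galeRyser-cut : ∀ (a : Vector ℕ p) (b : Vector ℕ q) → sum a ≡ sum b →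
                  (∀ (I : Vector (Fin 2) p) (J : Vector (Fin 2) q) →
                    sum (λ i → toℕ (I i) * a i) + sum (λ j → toℕ (J j) * b j)
                      ≤ sum b + sum (toℕ ∘ I) * sum (toℕ ∘ J)) →
                  ∃ λ (A : Fin p → Fin q → Fin 2) →
                      (∀ i → sum (λ j → toℕ (A i j)) ≡ a i)
                    × (∀ j → sum (λ i → toℕ (A i j)) ≡ b j)
  galeRyser-cut {p} {q} a b Σa≡Σb cut = galeRyser a b Σa≡Σb cond
    where
    open ≤-Reasoning
    cond : ∀ (I : Vector (Fin 2) p) →
           sum (λ i → toℕ (I i) * a i) ≤ sum (λ j → b j ⊓ sum (toℕ ∘ I))
    cond I = +-cancelʳ-≤ (sum (λ j → toℕ (J j) * b j)) _ _ (begin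
      sum (λ i → toℕ (I i) * a i) + sum (λ j → toℕ (J j) * b j)
        ≤⟨ cut I J ⟩
      sum b + r * sum (toℕ ∘ J)
        ≡⟨ cong (sum b +_) (*-comm r (sum (toℕ ∘ J))) ⟩
      sum b + sum (toℕ ∘ J) * r
        ≡⟨ cong (sum b +_) (sum-*ʳ (toℕ ∘ J) r) ⟨
      sum b + sum (λ j → toℕ (J j) * r)
        ≡⟨ ∑-distrib-+ b (λ j → toℕ (J j) * r) ⟨
      sum (λ j → b j + toℕ (J j) * r)
        ≡⟨ sum-cong-≗ (λ j → cong (λ y → b j + y * r) (toℕ-J j)) ⟩
      sum (λ j → b j + [ r < b j ]ᵢ * r)
        ≡⟨ sum-cong-≗ (λ j → ⊓-cut (b j) r) ⟨
      sum (λ j → b j ⊓ r + [ r < b j ]ᵢ * b j)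
        ≡⟨ sum-cong-≗ (λ j → cong (λ y → b j ⊓ r + y * b j) (toℕ-J j)) ⟨
      sum (λ j → b j ⊓ r + toℕ (J j) * b j)
        ≡⟨ ∑-distrib-+ (λ j → b j ⊓ r) (λ j → toℕ (J j) * b j) ⟩
      sum (λ j → b j ⊓ r) + sum (λ j → toℕ (J j) * b j) ∎)
      where
      r : ℕ
      r = sum (toℕ ∘ I)
      -- The columns of demand above `r` attain that minimum.
      J : Vector (Fin 2) q
      J j = fromℕ< (s≤s ([<]≤1 r (b j)))
      toℕ-J : ∀ j → toℕ (J j) ≡ [ r < b j ]ᵢ
      toℕ-J j = toℕ-fromℕ< _

  -- Partial sums bounded through the extreme degrees.

  module _ (I : Vector (Fin 2) n) where

    count≤ : sum (toℕ ∘ I) ≤ n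
    count≤ = begin
      sum (toℕ ∘ I)      ≤⟨ sum-mono (λ i → toℕ≤pred[n] (I i)) ⟩
      sum {n} (λ _ → 1)  ≡⟨ sum-const n 1 ⟩
      n * 1              ≡⟨ *-identityʳ n ⟩
      n                  ∎
      where open ≤-Reasoning

    subsum≤max : ∀ (a : Vector ℕ n) {M} → (∀ i → a i ≤ M) → sum (λ i → toℕ (I i) * a i) ≤ sum (toℕ ∘ I) * M
    subsum≤max a {M} a≤M = ≤-trans (sum-mono (λ i → *-monoʳ-≤ (toℕ (I i)) (a≤M i))) (≤-reflexive (sum-*ʳ (toℕ ∘ I) M))

    -- Each index outside `I` contributes at least `m` to the total.
    subsum+min≤ : ∀ (a : Vector ℕ n) {m} → (∀ i → m ≤ a i) →
                  sum (λ i → toℕ (I i) * a i) + n * m ≤ sum a + sum (toℕ ∘ I) * m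
    subsum+min≤ a {m} m≤a = begin
      sum (λ i → toℕ (I i) * a i) + n * m           ≡⟨ cong (_ +_) (sum-const n m) ⟨
      sum (λ i → toℕ (I i) * a i) + sum {n} (λ _ → m) ≡⟨ ∑-distrib-+ (λ i → toℕ (I i) * a i) (λ _ → m) ⟨
      sum (λ i → toℕ (I i) * a i + m)               ≤⟨ sum-mono (λ i → pointwise (I i) (m≤a i)) ⟩
      sum (λ i → a i + toℕ (I i) * m)               ≡⟨ ∑-distrib-+ a (λ i → toℕ (I i) * m) ⟩
      sum a + sum (λ i → toℕ (I i) * m)             ≡⟨ cong (sum a +_) (sum-*ʳ (toℕ ∘ I) m) ⟩
      sum a + sum (toℕ ∘ I) * m                     ∎
      where
      open ≤-Reasoning
      pointwise : ∀ (x : Fin 2) {y} → m ≤ y → toℕ x * y + m ≤ y + toℕ x * m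
      pointwise zero       m≤y = ≤-trans m≤y (m≤m+n _ 0)
      pointwise (suc zero) {y} _ = ≤-reflexive (cong₂ _+_ (*-identityˡ y) (sym (*-identityˡ m)))

open import Data.Integer as ℤ using (ℤ; +_; 0ℤ)
import Data.Integer.DivMod as ℤ
import Data.Integer.Properties as ℤₚ
open import Data.Integer.Tactic.RingSolver using (solve-∀)
open import Data.Rational as ℚ using (ℚ; 0ℚ; *≤*)
open import Data.Rational.Literals using (fromℤ)
import Data.Rational.Properties as ℚₚ
open import Data.Rational.Unnormalised using (*≡*)
import Data.Rational.Unnormalised.Properties as ℚᵘₚ

-- The cut inequality over the integers.

module CutInequality where

  open import Data.Integer
  open import Data.Integer.Properties

  0≤* : ∀ {i j} → 0ℤ ≤ i → 0ℤ ≤ j → 0ℤ ≤ i * j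
  0≤* {+ m} {+ n} _ _ = subst (0ℤ ≤_) (pos-* m n) (+≤+ ℕ.z≤n)

  infixl 6 _⊞_
  _⊞_ : ∀ {i j k l} → i ≤ j → k ≤ l → 0ℤ ≤ (j - i) + (l - k)
  p ⊞ q = +-mono-≤ (i≤j⇒0≤j-i p) (i≤j⇒0≤j-i q)

  infixl 7 _⊠_
  _⊠_ : ∀ {i j k l} → i ≤ j → k ≤ l → 0ℤ ≤ (j - i) * (l - k)
  p ⊠ q = 0≤* (i≤j⇒0≤j-i p) (i≤j⇒0≤j-i q)

  -- Each inequality below is certified by writing its slack as a sum of products of
  -- slacks of the hypotheses.
  certify : ∀ {i j d} → j - i ≡ d → 0ℤ ≤ d → i ≤ j
  certify eq 0≤d = 0≤i-j⇒j≤i (subst (0ℤ ≤_) (sym eq) 0≤d)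

  -- The radicand with n c̄ replaced by the total `S`, hence an integer.
  radicandℤ : (n m S : ℤ) → ℤ
  radicandℤ n m S = m * m + (S - n * (+ 2 * m))

  -- Expanding the squares, S - M² is the slack of the last hypothesis plus 2m(n - M).
  [M-m]²≤D⇒M²≤S : ∀ {n m M S} → 0ℤ ≤ m → M ≤ n → (M - m) * (M - m) ≤ radicandℤ n m S → M * M ≤ S
  [M-m]²≤D⇒M²≤S {n} {m} {M} {S} 0≤m M≤n h = certify (eq n m M S)
    (+-mono-≤ (i≤j⇒0≤j-i h) (+-mono-≤ (0≤m ⊠ M≤n) (0≤m ⊠ M≤n)))
    where
    eq : ∀ n m M S → S - M * M ≡
         (m * m + (S - n * (+ 2 * m)) - (M - m) * (M - m)) + ((m - 0ℤ) * (n - M) + (m - 0ℤ) * (n - M))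
    eq = solve-∀

  module _ {n m M S : ℤ} where

    -- What remains of a choice of `r` among `n` degrees in [m..M] with total `S` and chosen sum
    -- `X`.
    record PartialSum (r X : ℤ) : Set where
      field
        0≤r       : 0ℤ ≤ r
        r≤n       : r ≤ n
        X≤rM      : X ≤ r * M
        X+nm≤S+rm : X + n * m ≤ S + r * m

    module Cut (0≤m : 0ℤ ≤ m) (M≤n : M ≤ n)
               {r s X Y} (P : PartialSum r X) (Q : PartialSum s Y) where
      open PartialSum P
      open PartialSum Q renaming (0≤r to 0≤s; r≤n to s≤n; X≤rM to Y≤sM; X+nm≤S+rm to Y+nm≤S+sm)

      -- X ≤ S because the n - r omitted degrees are nonnegative, and Y ≤ sM ≤ rs.
      M≤r⇒cut : M ≤ r → X + Y ≤ S + r * s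
      M≤r⇒cut M≤r = certify (eq n m M S r s X Y)
        (+-mono-≤ (X+nm≤S+rm ⊞ Y≤sM) (+-mono-≤ (r≤n ⊠ 0≤m) (M≤r ⊠ 0≤s)))
        where
        eq : ∀ n m M S r s X Y → S + r * s - (X + Y) ≡
             (S + r * m - (X + n * m)) + (s * M - Y) + ((n - r) * (m - 0ℤ) + (r - M) * (s - 0ℤ))
        eq = solve-∀

      -- X ≤ rM ≤ rn, while each of the n - s degrees missing from `Y` is at least m ≥ r, so Y ≤ S -
      -- (n - s)r.
      r≤m⇒cut : r ≤ m → X + Y ≤ S + r * s
      r≤m⇒cut r≤m = certify (eq n m M S r s X Y)
        (+-mono-≤ (X≤rM ⊞ Y+nm≤S+sm) (+-mono-≤ (0≤r ⊠ M≤n) (r≤m ⊠ s≤n)))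
        where
        eq : ∀ n m M S r s X Y → S + r * s - (X + Y) ≡
             (r * M - X) + (S + s * m - (Y + n * m)) + ((r - 0ℤ) * (n - M) + (m - r) * (n - s))
        eq = solve-∀

      D≤0⇒cut : radicandℤ n m S ≤ 0ℤ → m ≤ r → m ≤ s → X + Y ≤ S + r * s
      D≤0⇒cut D≤0 m≤r m≤s = certify (eq n m S r s X Y)
        (+-mono-≤ (X+nm≤S+rm ⊞ Y+nm≤S+sm) (+-mono-≤ (i≤j⇒0≤j-i D≤0) (m≤r ⊠ m≤s)))
        where
        eq : ∀ n m S r s X Y → S + r * s - (X + Y) ≡
             (S + r * m - (X + n * m)) + (S + s * m - (Y + n * m))
             + ((0ℤ - (m * m + (S - n * (+ 2 * m)))) + (r - m) * (s - m))
        eq = solve-∀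

      -- X + Y ≤ (r + s)M = M² + rs - (M - r)(M - s).
      M²≤S⇒cut : M * M ≤ S → r ≤ M → s ≤ M → X + Y ≤ S + r * s
      M²≤S⇒cut M²≤S r≤M s≤M = certify (eq M S r s X Y)
        (+-mono-≤ (X≤rM ⊞ Y≤sM) (+-mono-≤ (i≤j⇒0≤j-i M²≤S) (r≤M ⊠ s≤M)))
        where
        eq : ∀ M S r s X Y → S + r * s - (X + Y) ≡
             (r * M - X) + (s * M - Y) + ((S - M * M) + (M - r) * (M - s))
        eq = solve-∀

      module _ {k} (m≤k : m ≤ k) (D≤[k-m]² : radicandℤ n m S ≤ (k - m) * (k - m)) where

        -- As for D ≤ 0, it suffices that D ≤ (r - m)(s - m), and this product is at least (k - m)².
        k≤r,s⇒cut : k ≤ r → k ≤ s → X + Y ≤ S + r * s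
        k≤r,s⇒cut k≤r k≤s = certify (eq n m S k r s X Y)
          (+-mono-≤ (+-mono-≤ (X+nm≤S+rm ⊞ Y+nm≤S+sm) (i≤j⇒0≤j-i D≤[k-m]²))
                    (+-mono-≤ (k≤r ⊠ ≤-trans m≤k k≤s) (m≤k ⊠ k≤s)))
          where
          eq : ∀ n m S k r s X Y → S + r * s - (X + Y) ≡
               (S + r * m - (X + n * m)) + (S + s * m - (Y + n * m))
               + ((k - m) * (k - m) - (m * m + (S - n * (+ 2 * m))))
               + ((r - k) * (s - m) + (k - m) * (s - k))
          eq = solve-∀

        module _ (k[M-m]≤S-nm : k * (M - m) ≤ S - n * m) where

          -- With X ≤ rM and Y ≤ S + sm - nm the slack is least at r = s = k, where it is the sum of
          -- the slacks of the two conditions on `k`.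
          r≤k≤s⇒cut : r ≤ k → k ≤ s → s ≤ M → X + Y ≤ S + r * s
          r≤k≤s⇒cut r≤k k≤s s≤M = certify (eq n m M S k r s X Y)
            (+-mono-≤ (+-mono-≤ (X≤rM ⊞ Y+nm≤S+sm) (k[M-m]≤S-nm ⊞ D≤[k-m]²))
                      (+-mono-≤ (r≤k ⊠ s≤M) (m≤k ⊠ k≤s)))
            where
            eq : ∀ n m M S k r s X Y → S + r * s - (X + Y) ≡
                 (r * M - X) + (S + s * m - (Y + n * m))
                 + ((S - n * m - k * (M - m)) + ((k - m) * (k - m) - (m * m + (S - n * (+ 2 * m)))))
                 + ((k - r) * (M - s) + (k - m) * (s - k))
            eq = solve-∀

          -- With X ≤ rM and Y ≤ sM the worst case is again r = s = k. There S + k² - 2kM is twice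
          -- the slack of the degree bound plus that of D ≤ (k - m)².
          r,s≤k⇒cut : r ≤ k → s ≤ k → k ≤ M → X + Y ≤ S + r * s
          r,s≤k⇒cut r≤k s≤k k≤M = certify (eq n m M S k r s X Y)
            (+-mono-≤ (+-mono-≤ (X≤rM ⊞ Y≤sM) (k[M-m]≤S-nm ⊞ D≤[k-m]²))
              (+-mono-≤ (+-mono-≤ (i≤j⇒0≤j-i k[M-m]≤S-nm) (r≤k ⊠ k≤M)) (+-mono-≤ (s≤k ⊠ k≤M) (r≤k ⊠ s≤k))))
            where
            eq : ∀ n m M S k r s X Y → S + r * s - (X + Y) ≡
                 (r * M - X) + (s * M - Y)
                 + ((S - n * m - k * (M - m)) + ((k - m) * (k - m) - (m * m + (S - n * (+ 2 * m)))))
                 + (((S - n * m - k * (M - m)) + (k - r) * (M - k)) + ((k - s) * (M - k) + (k - r) * (k - s)))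
            eq = solve-∀

  -- D ≤ 0, (M - m)² ≤ D and k ≤ M, each through the consequence that is used.
  data Regime (n m M S : ℤ) : Set where
    nonreal : radicandℤ n m S ≤ 0ℤ → Regime n m M S
    small   : M * M ≤ S → Regime n m M S
    large   : ∀ k → m ≤ k → k ≤ M → radicandℤ n m S ≤ (k - m) * (k - m) →
              k * (M - m) ≤ S - n * m → Regime n m M S

  flip-cut : ∀ S r s X Y → Y + X ≤ S + s * r → X + Y ≤ S + r * s
  flip-cut S r s X Y = subst₂ _≤_ (+-comm Y X) (cong (λ rs → S + rs) (*-comm s r))

  open Cut

  cut-bound : ∀ {n m M S} → 0ℤ ≤ m → M ≤ n → Regime n m M S →
              ∀ {r s X Y} → PartialSum {n} {m} {M} {S} r X → PartialSum {n} {m} {M} {S} s Y →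
              X + Y ≤ S + r * s
  cut-bound {n} {m} {M} {S} 0≤m M≤n regime {r} {s} {X} {Y} P Q
    with ≤-total M r | ≤-total M s | ≤-total r m | ≤-total s m
  ... | inj₁ M≤r | _ | _ | _ = M≤r⇒cut 0≤m M≤n P Q M≤r
  ... | _ | inj₁ M≤s | _ | _ = flip-cut S r s X Y (M≤r⇒cut 0≤m M≤n Q P M≤s)
  ... | _ | _ | inj₁ r≤m | _ = r≤m⇒cut 0≤m M≤n P Q r≤m
  ... | _ | _ | _ | inj₁ s≤m = flip-cut S r s X Y (r≤m⇒cut 0≤m M≤n Q P s≤m)
  ... | inj₂ r≤M | inj₂ s≤M | inj₂ m≤r | inj₂ m≤s with regime
  ... | nonreal D≤0 = D≤0⇒cut 0≤m M≤n P Q D≤0 m≤r m≤s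
  ... | small M²≤S = M²≤S⇒cut 0≤m M≤n P Q M²≤S r≤M s≤M
  ... | large k m≤k k≤M D≤ k[M-m]≤ with ≤-total k r | ≤-total k s
  ... | inj₁ k≤r | inj₁ k≤s = k≤r,s⇒cut 0≤m M≤n P Q m≤k D≤ k≤r k≤s
  ... | inj₂ r≤k | inj₁ k≤s = r≤k≤s⇒cut 0≤m M≤n P Q m≤k D≤ k[M-m]≤ r≤k k≤s s≤M
  ... | inj₁ k≤r | inj₂ s≤k = flip-cut S r s X Y (r≤k≤s⇒cut 0≤m M≤n Q P m≤k D≤ k[M-m]≤ s≤k k≤r r≤M)
  ... | inj₂ r≤k | inj₂ s≤k = r,s≤k⇒cut 0≤m M≤n P Q m≤k D≤ k[M-m]≤ r≤k s≤k k≤M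

-- From the rational threshold and degree bound to integer inequalities.

module Threshold where

  open CutInequality

  -- Passing to unnormalised fractions avoids the gcd in `ℚ.+`.
  fromℤ-+ : ∀ i j → fromℤ (i ℤ.+ j) ≡ fromℤ i ℚ.+ fromℤ j
  fromℤ-+ i j = ℚₚ.toℚᵘ-injective (ℚᵘₚ.≃-trans (*≡* (eq i j)) (ℚᵘₚ.≃-sym (ℚₚ.toℚᵘ-homo-+ (fromℤ i) (fromℤ j))))
    where
    eq : ∀ i j → (i ℤ.+ j) ℤ.* + 1 ≡ (i ℤ.* + 1 ℤ.+ j ℤ.* + 1) ℤ.* + 1
    eq = solve-∀

  fromℤ-* : ∀ i j → fromℤ (i ℤ.* j) ≡ fromℤ i ℚ.* fromℤ j
  fromℤ-* i j = ℚₚ.toℚᵘ-injective (ℚᵘₚ.≃-sym (ℚₚ.toℚᵘ-homo-* (fromℤ i) (fromℤ j)))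

  fromℤ-neg : ∀ i → fromℤ (ℤ.- i) ≡ ℚ.- fromℤ i
  fromℤ-neg i = ℚₚ.toℚᵘ-injective (ℚᵘₚ.≃-sym (ℚₚ.toℚᵘ-homo‿- (fromℤ i)))

  fromℤ-- : ∀ i j → fromℤ (i ℤ.- j) ≡ fromℤ i ℚ.- fromℤ j
  fromℤ-- i j = trans (fromℤ-+ i (ℤ.- j)) (cong (fromℤ i ℚ.+_) (fromℤ-neg j))

  fromℤ-mono-≤ : ∀ {i j} → i ℤ.≤ j → fromℤ i ℚ.≤ fromℤ j
  fromℤ-mono-≤ {i} {j} i≤j = *≤* (ℤₚ.*-monoʳ-≤-nonNeg (+ 1) i≤j)

  fromℤ-cancel-≤ : ∀ {i j} → fromℤ i ℚ.≤ fromℤ j → i ℤ.≤ j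
  fromℤ-cancel-≤ {i} {j} i≤j = subst₂ ℤ._≤_ (ℤₚ.*-identityʳ i) (ℤₚ.*-identityʳ j) (ℚₚ.drop-*≤* i≤j)

  -- Matching on `record{}` exposes the floor as the integer quotient of numerator by denominator.
  floor≤ : ∀ p → fromℤ (ℚ.floor p) ℚ.≤ p
  floor≤ p@record{} = *≤* (ℤₚ.≤-trans (ℤ.[n/d]*d≤n (ℚ.↥ p) (ℚ.↧ p)) (ℤₚ.≤-reflexive (sym (ℤₚ.*-identityʳ (ℚ.↥ p)))))

  *-distribˡ-- : ∀ p q r → p ℚ.* (q ℚ.- r) ≡ p ℚ.* q ℚ.- p ℚ.* r
  *-distribˡ-- p q r = trans (ℚₚ.*-distribˡ-+ p q (ℚ.- r)) (cong (p ℚ.* q ℚ.+_) (sym (ℚₚ.neg-distribʳ-* p r)))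

  p÷q*q≡p : ∀ p q .{{_ : ℚ.NonZero q}} → (p ℚ.÷ q) ℚ.* q ≡ p
  p÷q*q≡p p q = trans (ℚₚ.*-assoc p (ℚ.1/ q) q) (trans (cong (p ℚ.*_) (ℚₚ.*-inverseˡ q)) (ℚₚ.*-identityʳ p))

  module _ {n m S : ℕ} {c̄ : ℚ} (S≡nc̄ : fromℕ S ≡ fromℕ n ℚ.* c̄) where

    -- The average degree enters only multiplied by `n`, so it can be traded for the integer `S`.
    n*[c̄-i] : ∀ i → fromℕ n ℚ.* (c̄ ℚ.- fromℤ i) ≡ fromℤ (+ S ℤ.- + n ℤ.* i)
    n*[c̄-i] i = begin
      fromℕ n ℚ.* (c̄ ℚ.- fromℤ i)                ≡⟨ *-distribˡ-- (fromℕ n) c̄ (fromℤ i) ⟩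
      fromℕ n ℚ.* c̄ ℚ.- fromℕ n ℚ.* fromℤ i      ≡⟨ cong₂ ℚ._-_ S≡nc̄ (fromℤ-* (+ n) i) ⟨
      fromℕ S ℚ.- fromℤ (+ n ℤ.* i)              ≡⟨ fromℤ-- (+ S) (+ n ℤ.* i) ⟨
      fromℤ (+ S ℤ.- + n ℤ.* i)                  ∎
      where open ≡-Reasoning

    radicand≡ : radicand n m c̄ ≡ fromℤ (radicandℤ (+ n) (+ m) (+ S))
    radicand≡ = begin
      fromℕ m ℚ.* fromℕ m ℚ.+ fromℕ n ℚ.* (c̄ ℚ.- fromℕ 2 ℚ.* fromℕ m)
        ≡⟨ cong₂ (λ x y → x ℚ.+ fromℕ n ℚ.* (c̄ ℚ.- y)) (fromℤ-* (+ m) (+ m)) (fromℤ-* (+ 2) (+ m)) ⟨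
      fromℤ (+ m ℤ.* + m) ℚ.+ fromℕ n ℚ.* (c̄ ℚ.- fromℤ (+ 2 ℤ.* + m))
        ≡⟨ cong (fromℤ (+ m ℤ.* + m) ℚ.+_) (n*[c̄-i] (+ 2 ℤ.* + m)) ⟩
      fromℤ (+ m ℤ.* + m) ℚ.+ fromℤ (+ S ℤ.- + n ℤ.* (+ 2 ℤ.* + m))
        ≡⟨ fromℤ-+ (+ m ℤ.* + m) _ ⟨
      fromℤ (radicandℤ (+ n) (+ m) (+ S)) ∎
      where open ≡-Reasoning

    shifted-square : ∀ j → (fromℤ j ℚ.- fromℕ m) ℚ.* (fromℤ j ℚ.- fromℕ m) ≡ fromℤ ((j ℤ.- + m) ℤ.* (j ℤ.- + m))
    shifted-square j = trans (cong₂ ℚ._*_ (sym (fromℤ-- j (+ m))) (sym (fromℤ-- j (+ m)))) (sym (fromℤ-* (j ℤ.- + m) (j ℤ.- + m)))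

    -- At an integer the upper cut is a sign condition and a squared comparison, so no root
    -- survives.
    k*⇒ : ∀ {j} → k* n m c̄ (fromℤ j) → + m ℤ.≤ j × radicandℤ (+ n) (+ m) (+ S) ℤ.≤ (j ℤ.- + m) ℤ.* (j ℤ.- + m)
    k*⇒ {j} (0≤j-m , D≤) =
      ℤₚ.0≤i-j⇒j≤i (fromℤ-cancel-≤ (subst (0ℚ ℚ.≤_) (sym (fromℤ-- j (+ m))) 0≤j-m)) ,
      fromℤ-cancel-≤ (subst₂ ℚ._≤_ radicand≡ (shifted-square j) D≤)

    ⇒k* : ∀ {j} → + m ℤ.≤ j → radicandℤ (+ n) (+ m) (+ S) ℤ.≤ (j ℤ.- + m) ℤ.* (j ℤ.- + m) → k* n m c̄ (fromℤ j)
    ⇒k* {j} m≤j D≤ =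
      subst (0ℚ ℚ.≤_) (fromℤ-- j (+ m)) (fromℤ-mono-≤ (ℤₚ.i≤j⇒0≤j-i m≤j)) ,
      subst₂ ℚ._≤_ (sym radicand≡) (sym (shifted-square j)) (fromℤ-mono-≤ D≤)

    -- Drop the floor, subtract `m`, then clear the denominator by multiplying with k ≥ 0.
    degreeBound⇒ : ∀ {k M} .{{_ : ℚ.NonZero (fromℤ k)}} → 0ℤ ℤ.≤ k → M ℤ.≤ degreeBound n m c̄ k →
                   k ℤ.* (M ℤ.- + m) ℤ.≤ + S ℤ.- + n ℤ.* + m
    degreeBound⇒ {k} {M} 0≤k M≤ = fromℤ-cancel-≤ (begin
      fromℤ (k ℤ.* (M ℤ.- + m))                ≡⟨ cong fromℤ (ℤₚ.*-comm k _) ⟩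
      fromℤ ((M ℤ.- + m) ℤ.* k)                ≡⟨ trans (fromℤ-* (M ℤ.- + m) k) (cong (ℚ._* fromℤ k) (fromℤ-- M (+ m))) ⟩
      (fromℤ M ℚ.- fromℕ m) ℚ.* fromℤ k        ≤⟨ ℚₚ.*-monoʳ-≤-nonNeg (fromℤ k) {{ℚ.nonNegative (fromℤ-mono-≤ 0≤k)}} M-m≤ ⟩
      (fromℕ n ℚ.* q) ℚ.* fromℤ k              ≡⟨ ℚₚ.*-assoc (fromℕ n) q (fromℤ k) ⟩
      fromℕ n ℚ.* (q ℚ.* fromℤ k)              ≡⟨ cong (fromℕ n ℚ.*_) (p÷q*q≡p (c̄ ℚ.- fromℕ m) (fromℤ k)) ⟩
      fromℕ n ℚ.* (c̄ ℚ.- fromℕ m)              ≡⟨ n*[c̄-i] (+ m) ⟩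
      fromℤ (+ S ℤ.- + n ℤ.* + m)              ∎)
      where
      open ℚₚ.≤-Reasoning
      q : ℚ
      q = (c̄ ℚ.- fromℕ m) ℚ.÷ fromℤ k
      M-m≤ : fromℤ M ℚ.- fromℕ m ℚ.≤ fromℕ n ℚ.* q
      M-m≤ = begin
        fromℤ M ℚ.- fromℕ m                          ≤⟨ ℚₚ.+-monoˡ-≤ (ℚ.- fromℕ m) (ℚₚ.≤-trans (fromℤ-mono-≤ M≤) (floor≤ (fromℕ n ℚ.* q ℚ.+ fromℕ m))) ⟩
        (fromℕ n ℚ.* q ℚ.+ fromℕ m) ℚ.- fromℕ m      ≡⟨ ℚₚ.+-assoc (fromℕ n ℚ.* q) _ _ ⟩
        fromℕ n ℚ.* q ℚ.+ (fromℕ m ℚ.- fromℕ m)      ≡⟨ cong (fromℕ n ℚ.* q ℚ.+_) (ℚₚ.+-inverseʳ (fromℕ m)) ⟩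
        fromℕ n ℚ.* q ℚ.+ 0ℚ                         ≡⟨ ℚₚ.+-identityʳ _ ⟩
        fromℕ n ℚ.* q                                ∎

    regime : ∀ {k M} .{{_ : ℚ.NonZero (fromℤ k)}} → IsK n m c̄ k → + m ℤ.≤ M → M ℤ.≤ + n →
             M ℤ.≤ degreeBound n m c̄ k → Regime (+ n) (+ m) M (+ S)
    regime {k} {M} (real , _) m≤M M≤n M≤bound with ℤₚ.≤-total (radicandℤ (+ n) (+ m) (+ S)) 0ℤ
    ... | inj₁ D≤0 = nonreal D≤0
    ... | inj₂ 0≤D with real (subst (0ℚ ℚ.≤_) (sym radicand≡) (fromℤ-mono-≤ 0≤D))
                      | ℤₚ.≤-total (radicandℤ (+ n) (+ m) (+ S)) ((M ℤ.- + m) ℤ.* (M ℤ.- + m))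
    ... | _ | inj₂ [M-m]²≤D = small ([M-m]²≤D⇒M²≤S (ℤ.+≤+ ℕ.z≤n) M≤n [M-m]²≤D)
    -- Here `M` itself lies in the upper cut, so k ≤ M by minimality of the ceiling.
    ... | k*≤k , least | inj₁ D≤[M-m]² =
      let m≤k , D≤[k-m]² = k*⇒ k*≤k
      in large k m≤k (least M (⇒k* m≤M D≤[M-m]²)) D≤[k-m]²
           (degreeBound⇒ (ℤₚ.≤-trans (ℤ.+≤+ ℕ.z≤n) m≤k) M≤bound)

-- Assembly for bidegree sequences.

open GaleRyser
open CutInequality
open Threshold

theorem5 : (n : ℕ) (a b : Vector ℕ n) (c̄ : ℚ) →
    fromℕ (sum a) ≡ fromℕ n ℚ.* c̄ →
    fromℕ (sum b) ≡ fromℕ n ℚ.* c̄ →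
    (m : ℕ) → IsMin (entries (a , b)) m →
    (1≤m : 1 ℕ.≤ m) → m ℕ.≤ n →
    (k : ℤ) (isK : IsK n m c̄ k) →
    (M : ℕ) → IsMax (entries (a , b)) M →
    + M ℤ.≤ degreeBound n m c̄ k {{IsK⇒nonZero n m c̄ 1≤m isK}} ℤ.⊓ + n →
    GraphicWithLoops (a , b)
theorem5 n a b c̄ Σa≡nc̄ Σb≡nc̄ m (_ , m≤) 1≤m _ k isK M ((i , M≡) , ≤M) M≤ =
  galeRyser-cut a b Σa≡Σb cut
  where
  Σa≡Σb : sum a ≡ sum b
  Σa≡Σb = ℤₚ.+-injective (cong ℚ.numerator (trans Σa≡nc̄ (sym Σb≡nc̄)))

  M≤n : + M ℤ.≤ + n
  M≤n = ℤₚ.≤-trans M≤ (ℤₚ.i⊓j≤j _ (+ n))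

  M-regime : Regime (+ n) (+ m) (+ M) (+ sum b)
  -- m ≤ M is read off at the entry `i` that attains the maximum.
  M-regime = regime {n} {m} {sum b} {c̄} Σb≡nc̄ {k} {+ M} {{IsK⇒nonZero n m c̄ 1≤m isK}} isK
    (ℤ.+≤+ (subst (m ℕ.≤_) (sym M≡) (m≤ i))) M≤n (ℤₚ.≤-trans M≤ (ℤₚ.i⊓j≤i _ (+ n)))

  -- The total is expressed as `sum b`, so that rows and columns share the same `S`.
  partialSum : ∀ (I : Vector (Fin 2) n) (u : Vector ℕ n) → sum u ≡ sum b →
               (∀ i → m ℕ.≤ u i) → (∀ i → u i ℕ.≤ M) →
               PartialSum {+ n} {+ m} {+ M} {+ sum b}
                 (+ sum (toℕ ∘ I)) (+ sum (λ i → toℕ (I i) ℕ.* u i))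
  partialSum I u Σu≡Σb m≤u u≤M = record
    { 0≤r       = ℤ.+≤+ ℕ.z≤n
    ; r≤n       = ℤ.+≤+ (count≤ I)
    ; X≤rM      = subst (_ ℤ.≤_) (ℤₚ.pos-* r M) (ℤ.+≤+ (subsum≤max I u u≤M))
    ; X+nm≤S+rm = subst₂ ℤ._≤_
        (cong (λ nm → + X ℤ.+ nm) (ℤₚ.pos-* n m)) (cong₂ (λ S rm → + S ℤ.+ rm) Σu≡Σb (ℤₚ.pos-* r m))
        (ℤ.+≤+ (subsum+min≤ I u m≤u))
    }
    where
    r X : ℕ
    r = sum (toℕ ∘ I)
    X = sum (λ i → toℕ (I i) ℕ.* u i)

  cut : ∀ (I J : Vector (Fin 2) n) →
        sum (λ i → toℕ (I i) ℕ.* a i) ℕ.+ sum (λ j → toℕ (J j) ℕ.* b j)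
          ℕ.≤ sum b ℕ.+ sum (toℕ ∘ I) ℕ.* sum (toℕ ∘ J)
  cut I J = ℤₚ.drop‿+≤+
    (subst (λ rs → + (sum (λ i → toℕ (I i) ℕ.* a i) ℕ.+ sum (λ j → toℕ (J j) ℕ.* b j))
                     ℤ.≤ + sum b ℤ.+ rs)
      (sym (ℤₚ.pos-* (sum (toℕ ∘ I)) (sum (toℕ ∘ J))))
      (cut-bound (ℤ.+≤+ ℕ.z≤n) M≤n M-regime
        (partialSum I a Σa≡Σb (All.++⁻ˡ (m ℕ.≤_) a m≤) (All.++⁻ˡ (ℕ._≤ M) a ≤M))
        (partialSum J b refl (All.++⁻ʳ (m ℕ.≤_) a m≤) (All.++⁻ʳ (ℕ._≤ M) a ≤M))))
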